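{- Let $\ell\ge 5$ and let $\vec C$ be an orientation of the cycle $C_\ell$. If $G$ is a graph with $m(G)<m_2(C_\ell)$, then $G\not\to\vec C$, i.e., $G$ has an orientation containing no copy of $\vec C$.
   Context: $m(G)=\max\{e(J)/v(J):J\subseteq G,\ v(J)\ge1\}$ and $m_2(G)=\max\{(e(J)-1)/(v(J)-2):J\subseteq G,\ v(J)\ge3\}$; in particular $m_2(C_\ell)=(\ell-1)/(\ell-2)$. -}

module Defs where

open import Data.Nat using (ℕ; zero; suc; _+_; _*_; _<_; _≤_; _%_; _≡ᵇ_; _<ᵇ_)
open import Data.Bool using (Bool; true; false; _∧_; _∨_; if_then_else_)
open import Data.Fin using (Fin; toℕ)
open import Data.Product using (Σ; _×_)
open import Data.Sum using (_⊎_)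
open import Relation.Binary.PropositionalEquality using (_≡_)
open import Function.Definitions using (Injective)

-- A (di)graph on vertex set Fin n is given by a Boolean adjacency relation.
Rel₂ : ℕ → Set
Rel₂ n = Fin n → Fin n → Bool

IsSimpleGraph : {n : ℕ} → Rel₂ n → Set
IsSimpleGraph {n} A = (∀ u v → A u v ≡ A v u) × (∀ u → A u u ≡ false)

sumFin : {n : ℕ} → (Fin n → ℕ) → ℕ
sumFin {zero} f = 0
sumFin {suc n} f = f Fin.zero + sumFin (λ i → f (Fin.suc i))

b2n : Bool → ℕ
b2n true = 1
b2n false = 0

vCount : {n : ℕ} → (Fin n → Bool) → ℕ
vCount S = sumFin (λ u → b2n (S u))

eCount : {n : ℕ} → Rel₂ n → ℕ
eCount E = sumFin (λ u → sumFin (λ v → b2n ((toℕ u <ᵇ toℕ v) ∧ E u v)))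

IsSubgraph : {n : ℕ} → Rel₂ n → (Fin n → Bool) → Rel₂ n → Set
IsSubgraph A S E =
  (∀ u v → E u v ≡ true → (A u v ≡ true) × (S u ≡ true) × (S v ≡ true))
  × (∀ u v → E u v ≡ E v u)

-- m(G) < p / q  (q > 0), i.e. e(J)/v(J) < p/q for every subgraph J with v(J) ≥ 1
-- (m(G) is a maximum over finitely many subgraphs)
DensityBelow : {n : ℕ} → Rel₂ n → ℕ → ℕ → Set
DensityBelow {n} A p q =
  ∀ (S : Fin n → Bool) (E : Rel₂ n) → IsSubgraph A S E → 1 ≤ vCount S →
    eCount E * q < p * vCount S

cycleAdj : (ℓ : ℕ) → Rel₂ ℓ
cycleAdj zero u v = false
cycleAdj (suc k) u v =
  ((suc (toℕ u) % suc k) ≡ᵇ toℕ v) ∨ ((suc (toℕ v) % suc k) ≡ᵇ toℕ u)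

IsOrientation : {n : ℕ} → Rel₂ n → Rel₂ n → Set
IsOrientation A O =
  (∀ u v → A u v ≡ true →
     ((O u v ≡ true) × (O v u ≡ false)) ⊎ ((O u v ≡ false) × (O v u ≡ true)))
  × (∀ u v → O u v ≡ true → A u v ≡ true)

ContainsCopy : {k n : ℕ} → Rel₂ k → Rel₂ n → Set
ContainsCopy {k} {n} D O =
  Σ (Fin k → Fin n) λ f → Injective _≡_ _≡_ f × (∀ i j → D i j ≡ true → O (f i) (f j) ≡ true)

{-# OPTIONS --safe #-}
module Submission where

-- If C has three consecutive arcs in the same direction, 3-colour G (it is 2-degenerate) and orient
-- every edge towards the larger colour: no directed walk has three arcs.
--
-- Otherwise G is oriented by removing reducible configurations one at a time: a vertex of degree
-- at most 1; two adjacent vertices of degree 2, put back as a directed path with three arcs; or a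
-- vertex v of degree 3 with two neighbours of degree 2, put back so that a cycle through v
-- contains three consecutive arcs in the same direction or the pattern → → ← ←.
-- For ℓ = 5, 6 the cycle C avoids → → ← ← or ← ← → →, and discharging with m(G) < 4/3
-- finds one of the three configurations; for ℓ ≥ 7 discharging with m(G) < 6/5 finds one of
-- the first two.

open import Defs
open import Data.Bool using (Bool; true; false; _∧_; _∨_; not; if_then_else_) renaming (T to IsTrue)
open import Data.Bool.Properties using (∧-conicalˡ; ∧-conicalʳ; ∧-zeroʳ; ∧-identityʳ; ∨-zeroʳ; not-involutive; ¬-not) renaming (_≟_ to _≟ᵇ_)
open import Data.Empty using (⊥)
open import Data.Fin using (Fin; zero; suc; toℕ; fromℕ<)
open import Data.Fin.Properties using (_≟_; any?; ¬∀⟶∃¬; toℕ-injective; toℕ-fromℕ<; toℕ<n)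
open import Data.Nat using (ℕ; zero; suc; _+_; _*_; _∸_; _%_; _/_; _≤_; _<_; _≤?_; _<?_; _≡ᵇ_; _<ᵇ_; z≤n; s≤s; NonZero)
open import Data.Nat.DivMod using (m%n<n; [m+n]%n≡m%n; m<n⇒m%n≡m; m≡m%n+[m/n]*n; %-distribˡ-+)
open import Data.Nat.Properties hiding (_≟_)
open import Data.Nat.Tactic.RingSolver using (solve-∀)
open import Data.Product using (Σ; ∃; _×_; _,_; proj₁; proj₂)
open import Data.Sum using (_⊎_; inj₁; inj₂)
open import Data.Unit using (tt)
open import Function using (_∘_)
open import Relation.Binary.PropositionalEquality
open import Relation.Nullary using (¬_; Dec; yes; no; does; contradiction)
open import Relation.Nullary.Decidable using (dec-true; dec-false; _×-dec_)

-- Finite sums and counting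

sumFin-cong : ∀ {n} {f g : Fin n → ℕ} → (∀ i → f i ≡ g i) → sumFin f ≡ sumFin g
sumFin-cong {zero}  eq = refl
sumFin-cong {suc n} eq = cong₂ _+_ (eq zero) (sumFin-cong (eq ∘ suc))

sumFin-mono : ∀ {n} {f g : Fin n → ℕ} → (∀ i → f i ≤ g i) → sumFin f ≤ sumFin g
sumFin-mono {zero}  le = z≤n
sumFin-mono {suc n} le = +-mono-≤ (le zero) (sumFin-mono (le ∘ suc))

sumFin-mono-< : ∀ {n} {f g : Fin n → ℕ} → (∀ i → f i ≤ g i) → (j : Fin n) → f j < g j →
  sumFin f < sumFin g
sumFin-mono-< le zero    lt = +-mono-<-≤ lt (sumFin-mono (le ∘ suc))
sumFin-mono-< le (suc j) lt = +-mono-≤-< (le zero) (sumFin-mono-< (le ∘ suc) j lt)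

sumFin-+ : ∀ {n} (f g : Fin n → ℕ) → sumFin (λ i → f i + g i) ≡ sumFin f + sumFin g
sumFin-+ {zero}  f g = refl
sumFin-+ {suc n} f g = trans (cong (f zero + g zero +_) (sumFin-+ (f ∘ suc) (g ∘ suc)))
  (interchange (f zero) (g zero) _ _)
  where
  interchange : ∀ a b c d → a + b + (c + d) ≡ a + c + (b + d)
  interchange = solve-∀

sumFin-*ˡ : ∀ {n} (k : ℕ) (f : Fin n → ℕ) → sumFin (λ i → k * f i) ≡ k * sumFin f
sumFin-*ˡ {zero}  k f = sym (*-zeroʳ k)
sumFin-*ˡ {suc n} k f = trans (cong (k * f zero +_) (sumFin-*ˡ k (f ∘ suc)))
  (sym (*-distribˡ-+ k (f zero) _))

sumFin-zero : ∀ n → sumFin {n} (λ _ → 0) ≡ 0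
sumFin-zero zero    = refl
sumFin-zero (suc n) = sumFin-zero n

sumFin-swap : ∀ {m n} (f : Fin m → Fin n → ℕ) →
  sumFin (λ i → sumFin (f i)) ≡ sumFin (λ j → sumFin (λ i → f i j))
sumFin-swap {zero}  {n} f = sym (sumFin-zero n)
sumFin-swap {suc m} {n} f = trans (cong (sumFin (f zero) +_) (sumFin-swap (f ∘ suc)))
  (sym (sumFin-+ (f zero) _))

b2n-∧-≤ˡ : ∀ a b → b2n (a ∧ b) ≤ b2n a
b2n-∧-≤ˡ true  true  = s≤s z≤n
b2n-∧-≤ˡ true  false = z≤n
b2n-∧-≤ˡ false b     = z≤n

_∖_ : ∀ {n} → (Fin n → Bool) → (Fin n → Bool) → Fin n → Bool
(P ∖ Q) w = P w ∧ not (Q w)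

⁅_⁆ : ∀ {n} → Fin n → Fin n → Bool
⁅ v ⁆ w = does (w ≟ v)

∈⁅⁆⇒≡ : ∀ {n} {v w : Fin n} → ⁅ v ⁆ w ≡ true → w ≡ v
∈⁅⁆⇒≡ {v = v} {w} e with w ≟ v
... | yes p = p

∖-intro : ∀ {n} (P Q : Fin n → Bool) {w} → P w ≡ true → ¬ Q w ≡ true → (P ∖ Q) w ≡ true
∖-intro P Q {w} p ¬q rewrite p | ¬-not ¬q = refl

-- Serves both as the decrease in the inductions on vertex sets and as the way to peel off known
-- elements in the lower bounds below.
vCount-∖-< : ∀ {n} (P Q : Fin n → Bool) {v} → P v ≡ true → Q v ≡ true → vCount (P ∖ Q) < vCount P
vCount-∖-< P Q {v} p q = sumFin-mono-< (λ w → b2n-∧-≤ˡ (P w) (not (Q w))) v strict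
  where
  strict : b2n (P v ∧ not (Q v)) < b2n (P v)
  strict rewrite p | q = s≤s z≤n

vCount≥1 : ∀ {n} (P : Fin n → Bool) {v} → P v ≡ true → 1 ≤ vCount P
vCount≥1 P {v} p = ≤-<-trans z≤n (vCount-∖-< P ⁅ v ⁆ p (dec-true (v ≟ v) refl))

vCount≥2 : ∀ {n} (P : Fin n → Bool) {v w} → P v ≡ true → P w ≡ true → v ≢ w → 2 ≤ vCount P
vCount≥2 P {v} {w} p q v≢w = ≤-<-trans
  (vCount≥1 (P ∖ ⁅ v ⁆) (∖-intro P ⁅ v ⁆ q (v≢w ∘ sym ∘ ∈⁅⁆⇒≡)))
  (vCount-∖-< P ⁅ v ⁆ p (dec-true (v ≟ v) refl))

vCount≥3 : ∀ {n} (P : Fin n → Bool) {u v w} → P u ≡ true → P v ≡ true → P w ≡ true →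
  u ≢ v → u ≢ w → v ≢ w → 3 ≤ vCount P
vCount≥3 P {u} p q r u≢v u≢w v≢w = ≤-<-trans
  (vCount≥2 (P ∖ ⁅ u ⁆) (∖-intro P ⁅ u ⁆ q (u≢v ∘ sym ∘ ∈⁅⁆⇒≡))
    (∖-intro P ⁅ u ⁆ r (u≢w ∘ sym ∘ ∈⁅⁆⇒≡)) v≢w)
  (vCount-∖-< P ⁅ u ⁆ p (dec-true (u ≟ u) refl))

vCount≥4 : ∀ {n} (P : Fin n → Bool) {t u v w} →
  P t ≡ true → P u ≡ true → P v ≡ true → P w ≡ true →
  t ≢ u → t ≢ v → t ≢ w → u ≢ v → u ≢ w → v ≢ w → 4 ≤ vCount P
vCount≥4 P {t} o p q r t≢u t≢v t≢w u≢v u≢w v≢w = ≤-<-trans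
  (vCount≥3 (P ∖ ⁅ t ⁆) (∖-intro P ⁅ t ⁆ p (t≢u ∘ sym ∘ ∈⁅⁆⇒≡))
    (∖-intro P ⁅ t ⁆ q (t≢v ∘ sym ∘ ∈⁅⁆⇒≡)) (∖-intro P ⁅ t ⁆ r (t≢w ∘ sym ∘ ∈⁅⁆⇒≡)) u≢v u≢w v≢w)
  (vCount-∖-< P ⁅ t ⁆ o (dec-true (t ≟ t) refl))

1≤vCount⇒∃ : ∀ {n} (P : Fin n → Bool) → 1 ≤ vCount P → ∃ λ v → P v ≡ true
1≤vCount⇒∃ {suc n} P le with P zero in eq
... | true  = zero , eq
... | false with v , p ← 1≤vCount⇒∃ (P ∘ suc) le = suc v , p

2≤vCount⇒∃₂ : ∀ {n} (P : Fin n → Bool) → 2 ≤ vCount P →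
  Σ (Fin n) λ v → Σ (Fin n) λ w → v ≢ w × P v ≡ true × P w ≡ true
2≤vCount⇒∃₂ {suc n} P le with P zero in eq
... | true  with w , q ← 1≤vCount⇒∃ (P ∘ suc) (≤-pred le) = zero , suc w , (λ ()) , eq , q
... | false with v , w , v≢w , p , q ← 2≤vCount⇒∃₂ (P ∘ suc) le =
  suc v , suc w , (λ { refl → v≢w refl }) , p , q

-- Cyclic sign patterns

-- A sign sequence records the arcs met when reading around the cycle, unrolled to the natural
-- numbers, with `true` for an arc in the reading direction. The excluded patterns are → → → and ← ←
-- ←.
NoMonotone : (ℕ → Bool) → Set
NoMonotone c = ∀ k b → c k ≡ b → c (1 + k) ≡ b → c (2 + k) ≡ b → ⊥

-- The excluded pattern is → → ← ←. Applied to `not ∘ c`, the same predicate excludes ← ← → → from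
-- `c`.
NoSink : (ℕ → Bool) → Set
NoSink c = ∀ k → c k ≡ true → c (1 + k) ≡ true → c (2 + k) ≡ false → c (3 + k) ≡ false → ⊥

Periodic : ℕ → (ℕ → Bool) → Set
Periodic ℓ c = ∀ k → c (ℓ + k) ≡ c k

periodic-shift : ∀ {ℓ c} → Periodic ℓ c → ∀ j → Periodic ℓ (λ k → c (j + k))
periodic-shift {ℓ} {c} per j k = trans (cong c (swap j ℓ k)) (per (j + k))
  where
  swap : ∀ j ℓ k → j + (ℓ + k) ≡ ℓ + (j + k)
  swap = solve-∀

periodic-* : ∀ {ℓ c} → Periodic ℓ c → ∀ t k → c (t * ℓ + k) ≡ c k
periodic-* per zero    k = refl
periodic-* {ℓ} {c} per (suc t) k = trans (cong c (+-assoc ℓ (t * ℓ) k)) (trans (per (t * ℓ + k)) (periodic-* per t k))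

periodic-% : ∀ {ℓ c} .{{_ : NonZero ℓ}} → Periodic ℓ c → ∀ k → c k ≡ c (k % ℓ)
periodic-% {ℓ} {c} per k = trans
  (cong c (trans (m≡m%n+[m/n]*n k ℓ) (+-comm (k % ℓ) _)))
  (periodic-* per (k / ℓ) (k % ℓ))

MonotoneAt : (ℕ → Bool) → ℕ → Set
MonotoneAt c k = c k ≡ c (1 + k) × c (1 + k) ≡ c (2 + k)

-- By periodicity a monotone triple at `k` also occurs at the residue of `k`, so a search through
-- one period decides the question.
monotone? : ∀ {ℓ c} .{{_ : NonZero ℓ}} → Periodic ℓ c → ∃ (MonotoneAt c) ⊎ NoMonotone c
monotone? {ℓ} {c} per
  with any? {ℓ} (λ i → (c (toℕ i) ≟ᵇ c (1 + toℕ i)) ×-dec (c (1 + toℕ i) ≟ᵇ c (2 + toℕ i)))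
... | yes (i , p) = inj₁ (toℕ i , p)
... | no none = inj₂ λ k b p₀ p₁ p₂ →
  let r  = fromℕ< (m%n<n k ℓ)
      at = λ j → trans (periodic-% (periodic-shift {c = c} per j) k) (cong (λ x → c (j + x)) (sym (toℕ-fromℕ< (m%n<n k ℓ))))
  in none (r , trans (sym (at 0)) (trans p₀ (trans (sym p₁) (at 1)))
             , trans (sym (at 1)) (trans p₁ (trans (sym p₂) (at 2))))

-- Only one sign is left after + + - -. If it is -, it completes - - -; if it is +, it completes + +
-- + with the first two signs of the next period.
period-5⇒NoSink : ∀ {c} → Periodic 5 c → NoMonotone c → NoSink c
period-5⇒NoSink {c} per nomono k p₀ p₁ p₂ p₃ with c (4 + k) in p₄
... | false = nomono (2 + k) false p₂ p₃ p₄
... | true  = nomono (4 + k) true p₄ (trans (per k) p₀) (trans (periodic-shift {c = c} per 1 k) p₁)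

-- A pattern of period 6 containing + + − − must be + + − − + −, which avoids − − + +.
sink⇒no-source : ∀ {c} → Periodic 6 c → NoMonotone c →
  c 0 ≡ true → c 1 ≡ true → c 2 ≡ false → c 3 ≡ false → NoSink (not ∘ c)
sink⇒no-source {c} per nomono p₀ p₁ p₂ p₃ k q₀ q₁ q₂ q₃ = residue (k % 6) (m%n<n k 6) (at 0 q₀) (at 1 q₁) (at 2 q₂) (at 3 q₃)
  where
  p₄ : c 4 ≡ true
  p₄ = ¬-not λ e → nomono 2 false p₂ p₃ e
  p₅ : c 5 ≡ false
  p₅ = ¬-not λ e → nomono 4 true p₄ e (trans (per 0) p₀)
  at : ∀ j {b} → not (c (j + k)) ≡ b → not (c (j + k % 6)) ≡ b
  at j q = trans (cong not (sym (periodic-% (periodic-shift {c = c} per j) k))) q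
  clash : ∀ {x b} → x ≡ b → not x ≡ b → ⊥
  clash {true}  refl ()
  clash {false} refl ()
  residue : ∀ t → t < 6 → not (c t) ≡ true → not (c (1 + t)) ≡ true →
    not (c (2 + t)) ≡ false → not (c (3 + t)) ≡ false → ⊥
  residue 0 _ q₀ q₁ q₂ q₃ = clash p₀ q₀
  residue 1 _ q₀ q₁ q₂ q₃ = clash p₁ q₀
  residue 2 _ q₀ q₁ q₂ q₃ = clash p₅ q₃
  residue 3 _ q₀ q₁ q₂ q₃ = clash p₄ q₁
  residue 4 _ q₀ q₁ q₂ q₃ = clash p₄ q₀
  residue 5 _ q₀ q₁ q₂ q₃ = clash (trans (per 0) p₀) q₁
  residue (suc (suc (suc (suc (suc (suc t)))))) (s≤s (s≤s (s≤s (s≤s (s≤s (s≤s ())))))) _ _ _ _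

NoSink-unshift : ∀ {c} → Periodic 6 c → ∀ i → NoSink (λ t → not (c (i + t))) → NoSink (not ∘ c)
NoSink-unshift {c} per i nosink k q₀ q₁ q₂ q₃ =
  -- Modulo 6, adding `i * 5` undoes the shift by `i`.
  nosink (i * 5 + k) (at 0 q₀) (at 1 q₁) (at 2 q₂) (at 3 q₃)
  where
  regroup : ∀ i j k → i + (j + (i * 5 + k)) ≡ i * 6 + (j + k)
  regroup = solve-∀
  at : ∀ j {b} → not (c (j + k)) ≡ b → not (c (i + (j + (i * 5 + k)))) ≡ b
  at j q = trans (cong not (trans (cong c (regroup i j k)) (periodic-* per i (j + k)))) q

-- If + + - - occurs somewhere, rotate it to position 0, where it determines the whole period, and
-- rotate the conclusion back.
period-6⇒NoSink : ∀ {c} → Periodic 6 c → NoMonotone c → NoSink c ⊎ NoSink (not ∘ c)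
period-6⇒NoSink {c} per nomono
  with any? {6} (λ i → (c (toℕ i) ≟ᵇ true) ×-dec ((c (1 + toℕ i) ≟ᵇ true) ×-dec
                       ((c (2 + toℕ i) ≟ᵇ false) ×-dec (c (3 + toℕ i) ≟ᵇ false))))
... | yes (i , p₀ , p₁ , p₂ , p₃) = inj₂ (NoSink-unshift per (toℕ i)
  (sink⇒no-source (periodic-shift {c = c} per (toℕ i)) shifted (from 0 p₀) (from 1 p₁) (from 2 p₂) (from 3 p₃)))
  where
  from : ∀ j {b} → c (j + toℕ i) ≡ b → c (toℕ i + j) ≡ b
  from j = trans (cong c (+-comm (toℕ i) j))
  to : ∀ j k {b} → c (toℕ i + (j + k)) ≡ b → c (j + (toℕ i + k)) ≡ b
  to j k = trans (cong c (left-comm j (toℕ i) k))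
    where
    left-comm : ∀ j i k → j + (i + k) ≡ i + (j + k)
    left-comm = solve-∀
  shifted : NoMonotone (λ t → c (toℕ i + t))
  shifted k b q₀ q₁ q₂ = nomono (toℕ i + k) b q₀ (to 1 k q₁) (to 2 k q₂)
... | no none = inj₁ λ k p₀ p₁ p₂ p₃ →
  let at = λ j → trans (cong (λ x → c (j + x)) (toℕ-fromℕ< (m%n<n k 6))) (sym (periodic-% (periodic-shift {c = c} per j) k))
  in none (fromℕ< (m%n<n k 6) , trans (at 0) p₀ , trans (at 1) p₁ , trans (at 2) p₂ , trans (at 3) p₃)

<ᵇ-antisym : ∀ {a b} → a ≢ b → (a <ᵇ b) ≡ not (b <ᵇ a)
<ᵇ-antisym {zero}  {zero}  a≢b = contradiction refl a≢b
<ᵇ-antisym {zero}  {suc b} a≢b = refl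
<ᵇ-antisym {suc a} {zero}  a≢b = refl
<ᵇ-antisym {suc a} {suc b} a≢b = <ᵇ-antisym (a≢b ∘ cong suc)

<ᵇ≡true⇒< : ∀ {a b} → (a <ᵇ b) ≡ true → a < b
<ᵇ≡true⇒< {a} {b} e = <ᵇ⇒< a b (subst IsTrue (sym e) tt)

-- Degrees and discharging

-- This and the next three lemmas evaluate the discharging with r = 3 + `s` at a vertex of degree
-- `d` with `k` neighbours of degree 2. Outside the vertex set the target is 0, and the `k` units
-- handed out are covered by the initial charge.
charge-outside : ∀ s d k → k ≤ d → ¬ (3 + s) * d + 2 * b2n (d ≡ᵇ 2) < 2 * (4 + s) * 0 + k
charge-outside s d k k≤d = ≤⇒≯ (begin
  2 * (4 + s) * 0 + k              ≡⟨ cong (_+ k) (*-zeroʳ (2 * (4 + s))) ⟩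
  k                                ≤⟨ k≤d ⟩
  d                                ≤⟨ m≤m+n _ _ ⟩
  (3 + s) * d                      ≤⟨ m≤m+n _ _ ⟩
  (3 + s) * d + 2 * b2n (d ≡ᵇ 2)   ∎)
  where open ≤-Reasoning

-- With the 2 units received the vertex meets its target exactly, so it falls short only if it hands
-- something out.
charge-deg-2 : ∀ s k → (3 + s) * 2 + 2 < 2 * (4 + s) * 1 + k → 1 ≤ k
charge-deg-2 s k lt = +-cancelˡ-< (2 * (4 + s) * 1) 0 k (subst (_< 2 * (4 + s) * 1 + k) (balance s) lt)
  where
  balance : ∀ s → (3 + s) * 2 + 2 ≡ 2 * (4 + s) * 1 + 0
  balance = solve-∀

-- The initial charge exceeds the target by 1 + `s`, so a shortfall means handing out more than
-- that.
charge-deg-3 : ∀ s k → (3 + s) * 3 + 0 < 2 * (4 + s) * 1 + k → 2 + s ≤ k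
charge-deg-3 s k lt = +-cancelˡ-< (2 * (4 + s) * 1) (1 + s) k (subst (_< 2 * (4 + s) * 1 + k) (balance s) lt)
  where
  balance : ∀ s → (3 + s) * 3 + 0 ≡ 2 * (4 + s) * 1 + (1 + s)
  balance = solve-∀

-- Even after paying every neighbour, a vertex of degree 4 + `e` keeps a surplus of 2s + (2 + s)e.
charge-deg-≥4 : ∀ s e k → k ≤ 4 + e → ¬ (3 + s) * (4 + e) + 0 < 2 * (4 + s) * 1 + k
charge-deg-≥4 s e k k≤ = ≤⇒≯ (begin
  2 * (4 + s) * 1 + k                               ≤⟨ +-monoʳ-≤ (2 * (4 + s) * 1) k≤ ⟩
  2 * (4 + s) * 1 + (4 + e)                         ≤⟨ m≤m+n _ (2 * s + (2 + s) * e) ⟩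
  2 * (4 + s) * 1 + (4 + e) + (2 * s + (2 + s) * e) ≡⟨ balance s e ⟩
  (3 + s) * (4 + e) + 0                             ∎)
  where
  open ≤-Reasoning
  balance : ∀ s e → 2 * (4 + s) * 1 + (4 + e) + (2 * s + (2 + s) * e) ≡ (3 + s) * (4 + e) + 0
  balance = solve-∀

module Graph {n : ℕ} (A : Rel₂ n) (A-sym : ∀ u v → A u v ≡ A v u) (A-irr : ∀ u → A u u ≡ false) where

  induced : (Fin n → Bool) → Rel₂ n
  induced S u v = S u ∧ S v ∧ A u v

  deg : (Fin n → Bool) → Fin n → ℕ
  deg S u = vCount (induced S u)

  induced-intro : ∀ S {u v} → S u ≡ true → S v ≡ true → A u v ≡ true → induced S u v ≡ true
  induced-intro S su sv a rewrite su | sv = a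

  induced⇒Sˡ : ∀ S {u v} → induced S u v ≡ true → S u ≡ true
  induced⇒Sˡ S e = ∧-conicalˡ _ _ e

  induced⇒Sʳ : ∀ S {u v} → induced S u v ≡ true → S v ≡ true
  induced⇒Sʳ S {u} {v} e = ∧-conicalˡ (S v) _ (∧-conicalʳ (S u) _ e)

  induced⇒A : ∀ S {u v} → induced S u v ≡ true → A u v ≡ true
  induced⇒A S {u} {v} e = ∧-conicalʳ (S v) _ (∧-conicalʳ (S u) _ e)

  induced-sym : ∀ S u v → induced S u v ≡ induced S v u
  induced-sym S u v rewrite A-sym u v with S u | S v
  ... | true  | true  = refl
  ... | true  | false = refl
  ... | false | true  = refl
  ... | false | false = refl

  induced-irr : ∀ S u → induced S u u ≡ false
  induced-irr S u rewrite A-irr u with S u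
  ... | true  = refl
  ... | false = refl

  induced-isSubgraph : ∀ S → IsSubgraph A S (induced S)
  induced-isSubgraph S =
    (λ u v e → induced⇒A S e , induced⇒Sˡ S {u} {v} e , induced⇒Sʳ S {u} e) , induced-sym S

  b2n-split : ∀ {E : Rel₂ n} → (∀ u → E u u ≡ false) → ∀ u v →
    b2n (E u v) ≡ b2n ((toℕ u <ᵇ toℕ v) ∧ E u v) + b2n ((toℕ v <ᵇ toℕ u) ∧ E u v)
  b2n-split {E} irr u v with u ≟ v
  ... | yes refl rewrite irr u | ∧-zeroʳ (toℕ u <ᵇ toℕ u) = refl
  ... | no u≢v = go (toℕ u) (toℕ v) (u≢v ∘ toℕ-injective) (E u v)
    where
    go : ∀ a b → a ≢ b → ∀ x → b2n x ≡ b2n ((a <ᵇ b) ∧ x) + b2n ((b <ᵇ a) ∧ x)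
    go zero    zero    a≢b x = contradiction refl a≢b
    go zero    (suc b) a≢b x = sym (+-identityʳ _)
    go (suc a) zero    a≢b x = refl
    go (suc a) (suc b) a≢b x = go a b (a≢b ∘ cong suc) x

  -- `eCount` counts an edge only from its endpoint of smaller index. Each degree splits into larger
  -- and smaller neighbours, and exchanging the sums shows that both halves equal `eCount`.
  handshake : ∀ S → sumFin (deg S) ≡ 2 * eCount (induced S)
  handshake S = begin
    sumFin (λ u → sumFin (λ v → b2n (E u v)))
      ≡⟨ sumFin-cong (λ u → trans (sumFin-cong (b2n-split {E} (induced-irr S) u)) (sumFin-+ (up u) _)) ⟩
    sumFin (λ u → sumFin (up u) + sumFin (λ v → b2n ((toℕ v <ᵇ toℕ u) ∧ E u v)))
      ≡⟨ sumFin-+ (λ u → sumFin (up u)) _ ⟩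
    eCount E + sumFin (λ u → sumFin (λ v → b2n ((toℕ v <ᵇ toℕ u) ∧ E u v)))
      ≡⟨ cong (eCount E +_) (sumFin-cong (λ u → sumFin-cong (λ v →
           cong (λ e → b2n ((toℕ v <ᵇ toℕ u) ∧ e)) (induced-sym S u v)))) ⟩
    eCount E + sumFin (λ u → sumFin (λ v → up v u))
      ≡⟨ cong (eCount E +_) (sym (sumFin-swap up)) ⟩
    eCount E + eCount E
      ≡⟨ cong (eCount E +_) (sym (+-identityʳ _)) ⟩
    2 * eCount E ∎
    where
    open ≡-Reasoning
    E = induced S
    up : Fin n → Fin n → ℕ
    up u v = b2n ((toℕ u <ᵇ toℕ v) ∧ E u v)

  deg₂ : (Fin n → Bool) → Fin n → Bool
  deg₂ S w = deg S w ≡ᵇ 2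

  deg₂-nbrs : (Fin n → Bool) → Fin n → ℕ
  deg₂-nbrs S v = vCount (λ w → induced S v w ∧ deg₂ S w)

  deg₂-nbrs≤deg : ∀ S v → deg₂-nbrs S v ≤ deg S v
  deg₂-nbrs≤deg S v = sumFin-mono (λ w → b2n-∧-≤ˡ (induced S v w) (deg₂ S w))

  deg₂⇒≡2 : ∀ S {w} → deg₂ S w ≡ true → deg S w ≡ 2
  deg₂⇒≡2 S {w} e = ≡ᵇ⇒≡ (deg S w) 2 (subst IsTrue (sym e) tt)

  -- Double counting: each vertex of degree 2 is seen by its two neighbours. Hence the total charge
  -- handed out equals the total received.
  sum-deg₂-nbrs : ∀ S → sumFin (deg₂-nbrs S) ≡ 2 * vCount (deg₂ S)
  sum-deg₂-nbrs S = trans (sumFin-swap (λ v w → b2n (induced S v w ∧ deg₂ S w)))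
    (trans (sumFin-cong column) (sumFin-*ˡ 2 (b2n ∘ deg₂ S)))
    where
    column : ∀ w → sumFin (λ v → b2n (induced S v w ∧ deg₂ S w)) ≡ 2 * b2n (deg₂ S w)
    column w with deg₂ S w in eq
    ... | true  = trans (sumFin-cong (λ v → cong b2n (trans (∧-identityʳ _) (induced-sym S v w)))) (deg₂⇒≡2 S eq)
    ... | false = trans (sumFin-cong (λ v → cong b2n (∧-zeroʳ (induced S v w)))) (sumFin-zero n)

  -- Every vertex v starts with charge r · deg v and hands 1 to each neighbour of degree 2;
  -- since the final charges sum to less than 2 (1 + r) · |S|, some vertex of S ends below 2 (1 + r).
  undercharged : ∀ S r → eCount (induced S) * r < suc r * vCount S →
    ∃ λ v → r * deg S v + 2 * b2n (deg₂ S v) < 2 * suc r * b2n (S v) + deg₂-nbrs S v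
  undercharged S r sparse = proj₁ short , ≰⇒> (proj₂ short)
    where
    open ≤-Reasoning
    rearrange : ∀ r e → r * (2 * e) ≡ 2 * (e * r)
    rearrange = solve-∀
    ¬all : ¬ (∀ v → 2 * suc r * b2n (S v) + deg₂-nbrs S v ≤ r * deg S v + 2 * b2n (deg₂ S v))
    ¬all le = <-irrefl refl (<-≤-trans (*-monoʳ-< 2 sparse) (+-cancelʳ-≤ _ _ _ summed))
      where
      summed : 2 * (suc r * vCount S) + 2 * vCount (deg₂ S) ≤ 2 * (eCount (induced S) * r) + 2 * vCount (deg₂ S)
      summed = begin
        2 * (suc r * vCount S) + 2 * vCount (deg₂ S)
          ≡⟨ cong₂ _+_ (trans (sym (*-assoc 2 (suc r) _)) (sym (sumFin-*ˡ (2 * suc r) (b2n ∘ S)))) (sym (sum-deg₂-nbrs S)) ⟩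
        sumFin (λ v → 2 * suc r * b2n (S v)) + sumFin (deg₂-nbrs S)
          ≡⟨ sym (sumFin-+ _ (deg₂-nbrs S)) ⟩
        sumFin (λ v → 2 * suc r * b2n (S v) + deg₂-nbrs S v)
          ≤⟨ sumFin-mono le ⟩
        sumFin (λ v → r * deg S v + 2 * b2n (deg₂ S v))
          ≡⟨ sumFin-+ (λ v → r * deg S v) _ ⟩
        sumFin (λ v → r * deg S v) + sumFin (λ v → 2 * b2n (deg₂ S v))
          ≡⟨ cong₂ _+_ (trans (sumFin-*ˡ r (deg S)) (trans (cong (r *_) (handshake S)) (rearrange r (eCount (induced S))))) (sumFin-*ˡ 2 (b2n ∘ deg₂ S)) ⟩
        2 * (eCount (induced S) * r) + 2 * vCount (deg₂ S) ∎
    short = ¬∀⟶∃¬ n _ (λ v → _ ≤? _) ¬all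

  -- The parameter `s` stands for the density bound (4 + s) / (3 + s), the value of m_2 for the
  -- cycle of length 5 + `s`. A `tripod` can be forced by discharging only for `s ≤ 1`, and it
  -- records this.
  data Config (S : Fin n → Bool) (s : ℕ) : Set where
    leaf   : ∀ {v} → S v ≡ true → deg S v ≤ 1 → Config S s
    thread : ∀ {v x} → induced S v x ≡ true → deg S v ≡ 2 → deg S x ≡ 2 → Config S s
    tripod : ∀ {v x y} → s ≤ 1 → x ≢ y → induced S v x ≡ true → induced S v y ≡ true →
      deg S v ≡ 3 → deg S x ≡ 2 → deg S y ≡ 2 → Config S s

  -- Generalising `S v` and `deg S v` to `b` and `d` lets the case split on the degree simplify the
  -- charge inequality.
  undercharged⇒config : ∀ S s v b d → S v ≡ b → deg S v ≡ d →
    (3 + s) * d + 2 * b2n (d ≡ᵇ 2) < 2 * (4 + s) * b2n b + deg₂-nbrs S v → Config S s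
  undercharged⇒config S s v false d sv dv lt =
    contradiction lt (charge-outside s d (deg₂-nbrs S v) (subst (deg₂-nbrs S v ≤_) dv (deg₂-nbrs≤deg S v)))
  undercharged⇒config S s v true 0 sv dv lt = leaf sv (subst (_≤ 1) (sym dv) z≤n)
  undercharged⇒config S s v true 1 sv dv lt = leaf sv (subst (_≤ 1) (sym dv) ≤-refl)
  undercharged⇒config S s v true 2 sv dv lt
    with x , p ← 1≤vCount⇒∃ (λ w → induced S v w ∧ deg₂ S w) (charge-deg-2 s (deg₂-nbrs S v) lt) =
    thread (∧-conicalˡ _ _ p) dv (deg₂⇒≡2 S (∧-conicalʳ (induced S v x) _ p))
  undercharged⇒config S s v true 3 sv dv lt
    with x , y , x≢y , p , q ← 2≤vCount⇒∃₂ (λ w → induced S v w ∧ deg₂ S w)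
                                 (≤-trans (m≤m+n 2 s) (charge-deg-3 s (deg₂-nbrs S v) lt)) =
    -- At least 2 + `s` of the three neighbours have degree 2, hence `s ≤ 1`.
    tripod (≤-pred (≤-pred (≤-trans (charge-deg-3 s (deg₂-nbrs S v) lt) (subst (deg₂-nbrs S v ≤_) dv (deg₂-nbrs≤deg S v)))))
      x≢y (∧-conicalˡ _ _ p) (∧-conicalˡ _ _ q) dv
      (deg₂⇒≡2 S (∧-conicalʳ (induced S v x) _ p)) (deg₂⇒≡2 S (∧-conicalʳ (induced S v y) _ q))
  undercharged⇒config S s v true (suc (suc (suc (suc e)))) sv dv lt =
    contradiction lt (charge-deg-≥4 s e (deg₂-nbrs S v) (subst (deg₂-nbrs S v ≤_) dv (deg₂-nbrs≤deg S v)))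

  sparse⇒config : ∀ S s → eCount (induced S) * (3 + s) < (4 + s) * vCount S → Config S s
  sparse⇒config S s sparse = classify (undercharged S (3 + s) sparse)
    where
    classify : (∃ λ v → (3 + s) * deg S v + 2 * b2n (deg₂ S v) < 2 * (4 + s) * b2n (S v) + deg₂-nbrs S v) →
      Config S s
    classify (v , lt) = undercharged⇒config S s v (S v) (deg S v) refl refl lt

  deg≤2⇒passes : ∀ S {p v a b} → deg S p ≤ 2 → induced S p v ≡ true →
    induced S p a ≡ true → induced S p b ≡ true → a ≢ b → a ≡ v ⊎ b ≡ v
  deg≤2⇒passes S {p} {v} {a} {b} d pv pa pb a≢b with a ≟ v | b ≟ v
  ... | yes a≡v | _       = inj₁ a≡v
  ... | no _    | yes b≡v = inj₂ b≡v
  ... | no a≢v  | no b≢v  = contradiction d (<⇒≱ (vCount≥3 (induced S p) pa pb pv a≢b a≢v b≢v))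

  -- Orientations, walks and reattaching a removed configuration

  Sparse : ℕ → Set
  Sparse s = ∀ S → 1 ≤ vCount S → eCount (induced S) * (3 + s) < (4 + s) * vCount S

  -- Only adjacent pairs are constrained. Values elsewhere are arbitrary, so `attach` can be defined
  -- without consulting `A`.
  Antisym : Rel₂ n → Set
  Antisym T = ∀ u v → A u v ≡ true → T u v ≡ not (T v u)

  adjacent⇒≢ : ∀ {u v} → A u v ≡ true → u ≢ v
  adjacent⇒≢ {u} a refl = contradiction (trans (sym a) (A-irr u)) λ ()

  -- Walks replace copies of the oriented cycle: unrolled to ℕ, a copy is a non-backtracking
  -- walk whose k-th step is a forward arc exactly when c k is true.
  record Walk (c : ℕ → Bool) (S : Fin n → Bool) (T : Rel₂ n) : Set where
    field
      g            : ℕ → Fin n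
      inside       : ∀ k → S (g k) ≡ true
      step         : ∀ k → A (g k) (g (1 + k)) ≡ true
      sign         : ∀ k → T (g k) (g (1 + k)) ≡ c k
      no-backtrack : ∀ k → g k ≢ g (2 + k)
      recur        : ∀ k → ∃ λ j → g (2 + j) ≡ g k

  -- Arcs between `P` and `v` run to `v`, all other arcs at `v` leave it, and arcs between `P` and
  -- the remaining vertices enter `P`. For independent `P`, a path t, p, v, w with only p in `P`
  -- thus becomes directed, and one through two vertices of `P` reads → → ← ←.
  attach : Fin n → (Fin n → Bool) → Rel₂ n → Rel₂ n
  attach v P T u w =
    if ⁅ v ⁆ u then not (P w) else
    if ⁅ v ⁆ w then P u else
    if P u then false else
    if P w then true else T u w

  module Attach (v : Fin n) (P : Fin n → Bool) (T : Rel₂ n) where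

    attach-out : ∀ w → attach v P T v w ≡ not (P w)
    attach-out w rewrite dec-true (v ≟ v) refl = refl

    attach-in : ∀ {u} → u ≢ v → attach v P T u v ≡ P u
    attach-in {u} u≢v rewrite dec-false (u ≟ v) u≢v | dec-true (v ≟ v) refl = refl

    attach-from : ∀ {u w} → u ≢ v → w ≢ v → P u ≡ true → attach v P T u w ≡ false
    attach-from {u} {w} u≢v w≢v pu rewrite dec-false (u ≟ v) u≢v | dec-false (w ≟ v) w≢v | pu = refl

    attach-to : ∀ {u w} → u ≢ v → w ≢ v → P u ≡ false → P w ≡ true → attach v P T u w ≡ true
    attach-to {u} {w} u≢v w≢v pu pw
      rewrite dec-false (u ≟ v) u≢v | dec-false (w ≟ v) w≢v | pu | pw = refl

    attach-elsewhere : ∀ {u w} → u ≢ v → w ≢ v → P u ≡ false → P w ≡ false → attach v P T u w ≡ T u w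
    attach-elsewhere {u} {w} u≢v w≢v pu pw
      rewrite dec-false (u ≟ v) u≢v | dec-false (w ≟ v) w≢v | pu | pw = refl

    -- Independence matters because `attach` gives `false` in both directions between two vertices
    -- of `P`.
    attach-antisym : (∀ {a b} → P a ≡ true → A a b ≡ true → P b ≡ false) →
      Antisym T → Antisym (attach v P T)
    attach-antisym P-indep anti u w a with u ≟ v | w ≟ v
    ... | yes refl | yes refl = contradiction refl (adjacent⇒≢ a)
    ... | yes refl | no _     = refl
    ... | no _     | yes refl = sym (not-involutive (P u))
    ... | no _     | no _ with P u in pu | P w in pw
    ...   | true  | true  = contradiction (trans (sym (P-indep pu a)) pw) λ ()
    ...   | true  | false = refl
    ...   | false | true  = refl
    ...   | false | false = anti u w a

  -- The common interface of the three reductions: a walk passing through `P` must visit `v`, and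
  -- one passing through `v` must use `P` before or after it. `NoSink` is requested only when `P`
  -- has two distinct vertices.
  module Extend (c : ℕ → Bool) (c-nomono : NoMonotone c) (S : Fin n → Bool) (v : Fin n) (P : Fin n → Bool)
    (P-indep : ∀ {a b} → P a ≡ true → A a b ≡ true → P b ≡ false)
    (P-passes : ∀ {p a b} → P p ≡ true → induced S p a ≡ true → induced S p b ≡ true → a ≢ b → a ≡ v ⊎ b ≡ v)
    (v-meets-P : ∀ {a b} → induced S v a ≡ true → induced S v b ≡ true → a ≢ b → P a ≡ true ⊎ P b ≡ true)
    (c-nosink : ∀ {a b} → P a ≡ true → P b ≡ true → a ≢ b → NoSink c) where

    core : Fin n → Bool
    core w = ⁅ v ⁆ w ∨ P w

    -- The signs around `v` rule out a visit to `v`, hence one to `P`. The walk therefore stays off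
    -- `core`, where `attach` agrees with `T`.
    extend : ∀ T → ¬ Walk c (S ∖ core) T → ¬ Walk c S (attach v P T)
    extend T none W = none record
      { g = g
      ; inside = λ k → ∖-intro S core (inside k) (avoids-core k)
      ; step = step
      ; sign = λ k → trans (sym (attach-elsewhere (avoids-v k) (avoids-v (1 + k)) (avoids-P k) (avoids-P (1 + k)))) (sign k)
      ; no-backtrack = no-backtrack
      ; recur = recur
      }
      where
      open Walk W
      open Attach v P T

      back : ∀ k → A (g (1 + k)) (g k) ≡ true
      back k = trans (A-sym _ _) (step k)

      fwd-edge : ∀ k → induced S (g k) (g (1 + k)) ≡ true
      fwd-edge k = induced-intro S (inside k) (inside (1 + k)) (step k)

      bwd-edge : ∀ k → induced S (g (1 + k)) (g k) ≡ true
      bwd-edge k = induced-intro S (inside (1 + k)) (inside k) (back k)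

      through-v : ∀ k → g (2 + k) ≡ v → ⊥
      through-v k at = by-cases (P a) (P b) refl refl
        where
        a = g (1 + k)
        b = g (3 + k)
        a≢v : a ≢ v
        a≢v e = adjacent⇒≢ (step (1 + k)) (trans e (sym at))
        b≢v : b ≢ v
        b≢v e = adjacent⇒≢ (back (2 + k)) (trans e (sym at))
        enter : c (1 + k) ≡ P a
        enter = trans (sym (sign (1 + k))) (trans (cong (attach v P T a) at) (attach-in a≢v))
        leave : c (2 + k) ≡ not (P b)
        leave = trans (sym (sign (2 + k))) (trans (cong (λ u → attach v P T u b) at) (attach-out b))
        before : P a ≡ true → c k ≡ true
        before pa = trans (sym (sign k)) (attach-to
          (λ e → no-backtrack k (trans e (sym at))) a≢v (P-indep pa (back k)) pa)
        after : P b ≡ true → c (3 + k) ≡ false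
        after pb = trans (sym (sign (3 + k))) (attach-from b≢v
          (λ e → no-backtrack (2 + k) (trans at (sym e))) pb)
        -- The first three cases force + + - -, + + + and - - -; in the last, `v` would be passed
        -- without using `P`.
        by-cases : ∀ x y → P a ≡ x → P b ≡ y → ⊥
        by-cases true true pa pb = c-nosink pa pb (no-backtrack (1 + k)) k
          (before pa) (trans enter pa) (trans leave (cong not pb)) (after pb)
        by-cases true false pa pb = c-nomono k true (before pa) (trans enter pa) (trans leave (cong not pb))
        by-cases false true pa pb = c-nomono (1 + k) false (trans enter pa) (trans leave (cong not pb)) (after pb)
        by-cases false false pa pb
          with v-meets-P (subst (λ u → induced S u a ≡ true) at (bwd-edge (1 + k)))
                 (subst (λ u → induced S u b ≡ true) at (fwd-edge (2 + k))) (no-backtrack (1 + k))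
        ... | inj₁ p = contradiction (trans (sym p) pa) λ ()
        ... | inj₂ p = contradiction (trans (sym p) pb) λ ()

      avoids-v : ∀ k → g k ≢ v
      -- `recur` moves the visit to an index at least 2, so that two steps precede it.
      avoids-v k e with j , eq ← recur k = through-v j (trans eq e)

      through-P : ∀ k → P (g (1 + k)) ≡ true → ⊥
      through-P k p with P-passes p (bwd-edge k) (fwd-edge (1 + k)) (no-backtrack k)
      ... | inj₁ e = avoids-v k e
      ... | inj₂ e = avoids-v (2 + k) e

      avoids-P : ∀ k → P (g k) ≡ false
      avoids-P k with j , eq ← recur k = trans (cong P (sym eq)) (¬-not (through-P (1 + j)))

      avoids-core : ∀ k → ¬ core (g k) ≡ true
      avoids-core k e rewrite dec-false (g k ≟ v) (avoids-v k) | avoids-P k = contradiction e λ ()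

  -- Induction over reducible configurations

  Result : (ℕ → Bool) → (Fin n → Bool) → Set
  Result c S = ∃ λ T → Antisym T × ¬ Walk c S T

  -- The removed `P` is empty for a leaf, `x` alone for a thread, and the pair `x`, `y` for a
  -- tripod.
  extend-config : ∀ c s S → NoMonotone c → (s ≤ 1 → NoSink c) → Config S s →
    (∀ S′ → vCount S′ < vCount S → Result c S′) → Result c S
  extend-config c s S nomono nosink config rec = by config
    where
    glue : ∀ {v} (P : Fin n → Bool) → S v ≡ true →
      (∀ {a b} → P a ≡ true → A a b ≡ true → P b ≡ false) →
      (∀ {p a b} → P p ≡ true → induced S p a ≡ true → induced S p b ≡ true → a ≢ b → a ≡ v ⊎ b ≡ v) →
      (∀ {a b} → induced S v a ≡ true → induced S v b ≡ true → a ≢ b → P a ≡ true ⊎ P b ≡ true) →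
      (∀ {a b} → P a ≡ true → P b ≡ true → a ≢ b → NoSink c) → Result c S
    glue {v} P sv indep passes meets ns =
      reattach (rec (S ∖ core) (vCount-∖-< S core sv (cong (_∨ P v) (dec-true (v ≟ v) refl))))
      where
      open Extend c nomono S v P indep passes meets ns
      reattach : Result c (S ∖ core) → Result c S
      reattach (T , anti , none) = attach v P T , Attach.attach-antisym v P T indep anti , extend T none

    rev : ∀ {u w} → induced S u w ≡ true → induced S w u ≡ true
    rev {u} {w} = trans (induced-sym S w u)

    on-thread : ∀ {v x} → induced S v x ≡ true → deg S v ≡ 2 → deg S x ≡ 2 → Result c S
    on-thread {v} {x} vx dv dx = glue ⁅ x ⁆ (induced⇒Sˡ S {v} {x} vx) indep passes meets
      (λ p q a≢b → contradiction (trans (∈⁅⁆⇒≡ {v = x} p) (sym (∈⁅⁆⇒≡ q))) a≢b)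
      where
      indep : ∀ {a b} → ⁅ x ⁆ a ≡ true → A a b ≡ true → ⁅ x ⁆ b ≡ false
      indep {a} {b} p ab = dec-false (b ≟ x) λ b≡x → adjacent⇒≢ ab (trans (∈⁅⁆⇒≡ p) (sym b≡x))
      passes : ∀ {p a b} → ⁅ x ⁆ p ≡ true → induced S p a ≡ true → induced S p b ≡ true → a ≢ b → a ≡ v ⊎ b ≡ v
      passes {p} p∈ with refl ← ∈⁅⁆⇒≡ {v = x} {p} p∈ = deg≤2⇒passes S (≤-reflexive dx) (rev vx)
      meets : ∀ {a b} → induced S v a ≡ true → induced S v b ≡ true → a ≢ b → ⁅ x ⁆ a ≡ true ⊎ ⁅ x ⁆ b ≡ true
      meets {a} {b} va vb a≢b with deg≤2⇒passes S (≤-reflexive dv) vx va vb a≢b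
      ... | inj₁ a≡x = inj₁ (dec-true (a ≟ x) a≡x)
      ... | inj₂ b≡x = inj₂ (dec-true (b ≟ x) b≡x)

    by : Config S s → Result c S
    by (leaf {v} sv d≤1) = glue (λ _ → false) sv (λ ()) (λ ())
      (λ va vb a≢b → contradiction d≤1 (<⇒≱ (vCount≥2 (induced S v) va vb a≢b))) (λ ())
    by (thread vx dv dx) = on-thread vx dv dx
    by (tripod {v} {x} {y} s≤1 x≢y vx vy dv dx dy) with A x y in xy
    -- Adjacent `x` and `y` of degree 2 themselves form a thread; otherwise the pair is independent.
    ... | true  = on-thread (induced-intro S (induced⇒Sʳ S {v} vx) (induced⇒Sʳ S {v} vy) xy) dx dy
    ... | false = glue P (induced⇒Sˡ S {v} {x} vx) indep passes meets (λ _ _ _ → nosink s≤1)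
      where
      P : Fin n → Bool
      P w = ⁅ x ⁆ w ∨ ⁅ y ⁆ w
      P-elim : ∀ {w} → P w ≡ true → w ≡ x ⊎ w ≡ y
      P-elim {w} p with w ≟ x | w ≟ y
      ... | yes e | _     = inj₁ e
      ... | no _  | yes e = inj₂ e
      P-intro : ∀ {w} → w ≡ x ⊎ w ≡ y → P w ≡ true
      P-intro {w} (inj₁ e) = cong (_∨ ⁅ y ⁆ w) (dec-true (w ≟ x) e)
      P-intro {w} (inj₂ e) = trans (cong (⁅ x ⁆ w ∨_) (dec-true (w ≟ y) e)) (∨-zeroʳ _)
      indep : ∀ {a b} → P a ≡ true → A a b ≡ true → P b ≡ false
      indep {a} {b} pa ab = ¬-not λ pb → clash (P-elim {a} pa) (P-elim {b} pb) ab
        where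
        clash : ∀ {a b} → a ≡ x ⊎ a ≡ y → b ≡ x ⊎ b ≡ y → A a b ≡ true → ⊥
        clash (inj₁ refl) (inj₁ refl) ab = adjacent⇒≢ ab refl
        clash (inj₁ refl) (inj₂ refl) ab = contradiction (trans (sym ab) xy) λ ()
        clash (inj₂ refl) (inj₁ refl) ab = contradiction (trans (sym ab) (trans (A-sym y x) xy)) λ ()
        clash (inj₂ refl) (inj₂ refl) ab = adjacent⇒≢ ab refl
      passes : ∀ {p a b} → P p ≡ true → induced S p a ≡ true → induced S p b ≡ true → a ≢ b → a ≡ v ⊎ b ≡ v
      passes {p} p∈ with P-elim {p} p∈
      ... | inj₁ refl = deg≤2⇒passes S (≤-reflexive dx) (rev vx)
      ... | inj₂ refl = deg≤2⇒passes S (≤-reflexive dy) (rev vy)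
      meets : ∀ {a b} → induced S v a ≡ true → induced S v b ≡ true → a ≢ b → P a ≡ true ⊎ P b ≡ true
      meets {a} {b} va vb a≢b with a ≟ x | a ≟ y | b ≟ x | b ≟ y
      ... | yes _  | _      | _      | _      = inj₁ refl
      ... | no _   | yes _  | _      | _      = inj₁ refl
      ... | no _   | no _   | yes _  | _      = inj₂ refl
      ... | no _   | no _   | no _   | yes _  = inj₂ refl
      -- Otherwise `a`, `b`, `x`, `y` would be four distinct neighbours of a vertex of degree 3.
      ... | no a≢x | no a≢y | no b≢x | no b≢y = contradiction (≤-reflexive dv)
        (<⇒≱ (vCount≥4 (induced S v) va vb vx vy a≢b a≢x a≢y b≢x b≢y x≢y))

  -- Strong induction on the number of vertices, with `m` as an upper bound. On the empty set any
  -- orientation will do, since a walk would need a vertex.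
  orient-nonmonotone : ∀ c s → NoMonotone c → (s ≤ 1 → NoSink c) → Sparse s →
    ∀ m S → vCount S ≤ m → Result c S
  orient-nonmonotone c s nomono nosink sparse m S size with 1 ≤? vCount S
  ... | no empty = (λ u w → toℕ u <ᵇ toℕ w) , (λ u w a → <ᵇ-antisym (adjacent⇒≢ a ∘ toℕ-injective))
    , λ W → empty (vCount≥1 S (Walk.inside W 0))
  orient-nonmonotone c s nomono nosink sparse zero    S size | yes nonempty = contradiction (≤-trans nonempty size) λ ()
  orient-nonmonotone c s nomono nosink sparse (suc m) S size | yes nonempty =
    extend-config c s S nomono nosink (sparse⇒config S s (sparse S nonempty))
      (λ S′ lt → orient-nonmonotone c s nomono nosink sparse m S′ (≤-pred (≤-trans lt size)))

  -- Reversing all arcs negates every sign of a walk; this exchanges → → ← ← and ← ← → →.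
  Result-reverse : ∀ c S → Result (not ∘ c) S → Result c S
  Result-reverse c S (T , anti , none) = (λ u w → T w u)
    , (λ u w a → anti w u (trans (A-sym w u) a))
    , λ W → let open Walk W in none record
        { g = g
        ; inside = inside
        ; step = step
        ; sign = λ k → trans (anti _ _ (step k)) (cong not (sign k))
        ; no-backtrack = no-backtrack
        ; recur = recur
        }

  -- Three-colourings

  Proper : (Fin n → Bool) → (Fin n → Fin 3) → Set
  Proper S κ = ∀ {u w} → induced S u w ≡ true → κ u ≢ κ w

  -- Gives 2-degeneracy from the discharging already done, and with it a greedy 3-colouring.
  config⇒deg≤2 : ∀ {S s} → Config S s → ∃ λ v → S v ≡ true × deg S v ≤ 2
  config⇒deg≤2 (leaf sv d≤1) = _ , sv , ≤-trans d≤1 (s≤s z≤n)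
  config⇒deg≤2 {S} (thread {v} {x} vx dv dx) = _ , induced⇒Sˡ S {v} {x} vx , ≤-reflexive dv
  config⇒deg≤2 {S} (tripod {v} _ _ vx _ _ dx _) = _ , induced⇒Sʳ S {v} vx , ≤-reflexive dx

  used? : ∀ S (κ : Fin n → Fin 3) v k → Dec (∃ λ w → induced S v w ≡ true × κ w ≡ k)
  used? S κ v k = any? (λ w → (induced S v w ≟ᵇ true) ×-dec (κ w ≟ k))

  free-colour : ∀ S {v} (κ : Fin n → Fin 3) → deg S v ≤ 2 →
    ∃ λ k → ∀ {w} → induced S v w ≡ true → κ w ≢ k
  free-colour S {v} κ d with used? S κ v zero | used? S κ v (suc zero) | used? S κ v (suc (suc zero))
  ... | no none | _ | _ = _ , λ e eq → none (_ , e , eq)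
  ... | yes _ | no none | _ = _ , λ e eq → none (_ , e , eq)
  ... | yes _ | yes _ | no none = _ , λ e eq → none (_ , e , eq)
  ... | yes (a , va , ka) | yes (b , vb , kb) | yes (c , vc , kc) = contradiction d
    (<⇒≱ (vCount≥3 (induced S v) va vb vc (differ ka kb λ ()) (differ ka kc λ ()) (differ kb kc λ ())))
    where
    differ : ∀ {x y i j} → κ x ≡ i → κ y ≡ j → i ≢ j → x ≢ y
    differ p q i≢j refl = i≢j (trans (sym p) q)

  recolour : (Fin n → Fin 3) → Fin n → Fin 3 → Fin n → Fin 3
  recolour κ v k w = if ⁅ v ⁆ w then k else κ w

  recolour-proper : ∀ S {v} κ k → Proper (S ∖ ⁅ v ⁆) κ → (∀ {w} → induced S v w ≡ true → κ w ≢ k) →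
    Proper S (recolour κ v k)
  recolour-proper S {v} κ k proper free {u} {w} e with u ≟ v | w ≟ v
  ... | yes refl | yes refl = contradiction refl (adjacent⇒≢ (induced⇒A S e))
  ... | yes refl | no _     = free e ∘ sym
  ... | no _     | yes refl = free (trans (induced-sym S w u) e)
  ... | no u≢v   | no w≢v   = proper (induced-intro (S ∖ ⁅ v ⁆)
    (∖-intro S ⁅ v ⁆ (induced⇒Sˡ S {u} {w} e) (u≢v ∘ ∈⁅⁆⇒≡))
    (∖-intro S ⁅ v ⁆ (induced⇒Sʳ S {u} e) (w≢v ∘ ∈⁅⁆⇒≡)) (induced⇒A S e))

  extend-colouring : ∀ S → (∃ λ v → S v ≡ true × deg S v ≤ 2) →
    (∀ S′ → vCount S′ < vCount S → ∃ (Proper S′)) → ∃ (Proper S)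
  extend-colouring S (v , sv , d) rec = recolour κ v k , recolour-proper S κ k (proj₂ coloured) (proj₂ free)
    where
    coloured : ∃ (Proper (S ∖ ⁅ v ⁆))
    coloured = rec (S ∖ ⁅ v ⁆) (vCount-∖-< S ⁅ v ⁆ sv (dec-true (v ≟ v) refl))
    κ = proj₁ coloured
    free : ∃ λ k → ∀ {w} → induced S v w ≡ true → κ w ≢ k
    free = free-colour S κ d
    k = proj₁ free

  three-colouring : ∀ s → Sparse s → ∀ m S → vCount S ≤ m → ∃ (Proper S)
  three-colouring s sparse m S size with 1 ≤? vCount S
  ... | no empty = (λ _ → zero) , λ {u} {w} e → contradiction (vCount≥1 S (induced⇒Sˡ S {u} {w} e)) empty
  three-colouring s sparse zero    S size | yes nonempty = contradiction (≤-trans nonempty size) λ ()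
  three-colouring s sparse (suc m) S size | yes nonempty =
    extend-colouring S (config⇒deg≤2 (sparse⇒config S s (sparse S nonempty)))
      (λ S′ lt → three-colouring s sparse m S′ (≤-pred (≤-trans lt size)))

  -- Orienting the whole graph

  whole : Fin n → Bool
  whole _ = true

  orient-monotone : ∀ c s → ∃ (MonotoneAt c) → Sparse s → Result c whole
  orient-monotone c s (k , e₀ , e₁) sparse with κ , proper ← three-colouring s sparse _ whole ≤-refl =
    T , anti , no-walk
    where
    T : Rel₂ n
    T u w = toℕ (κ u) <ᵇ toℕ (κ w)
    anti : Antisym T
    anti u w a = <ᵇ-antisym (proper a ∘ toℕ-injective)
    climb : ∀ {t u v w} → T t u ≡ true → T u v ≡ true → T v w ≡ true → ⊥
    -- Three increasing steps would need four colours.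
    climb {t} {u} {v} {w} p q r = <⇒≱ (toℕ<n (κ w)) (≤-trans (s≤s (≤-trans (s≤s (≤-trans (s≤s z≤n)
      (<ᵇ≡true⇒< p))) (<ᵇ≡true⇒< q))) (<ᵇ≡true⇒< r))
    no-walk : ¬ Walk c whole T
    no-walk W = by (c k) refl
      where
      open Walk W
      down : ∀ j → c j ≡ false → T (g (1 + j)) (g j) ≡ true
      down j e = trans (anti _ _ (trans (A-sym _ _) (step j))) (cong not (trans (sign j) e))
      by : ∀ b → c k ≡ b → ⊥
      by true  e = climb {g k} {g (1 + k)} {g (2 + k)} {g (3 + k)} (trans (sign k) e)
        (trans (sign (1 + k)) (trans (sym e₀) e)) (trans (sign (2 + k)) (trans (sym e₁) (trans (sym e₀) e)))
      -- Three backward arcs form an increasing path when read from the far end.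
      by false e = climb {g (3 + k)} {g (2 + k)} {g (1 + k)} {g k}
        (down (2 + k) (trans (sym e₁) (trans (sym e₀) e))) (down (1 + k) (trans (sym e₀) e)) (down k e)

  orient : ∀ m c → Periodic (5 + m) c → (∀ s → s ≤ m → Sparse s) → Result c whole
  orient m c per sparse with monotone? {5 + m} {c} per
  ... | inj₁ mono = orient-monotone c 0 mono (sparse 0 z≤n)
  orient 0 c per sparse | inj₂ nomono =
    orient-nonmonotone c 0 nomono (λ _ → period-5⇒NoSink per nomono) (sparse 0 z≤n) _ whole ≤-refl
  orient 1 c per sparse | inj₂ nomono with period-6⇒NoSink per nomono
  ... | inj₁ nosink = orient-nonmonotone c 0 nomono (λ _ → nosink) (sparse 0 z≤n) _ whole ≤-refl
  ... | inj₂ nosource = Result-reverse c whole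
    (orient-nonmonotone (not ∘ c) 0 nomono′ (λ _ → nosource) (sparse 0 z≤n) _ whole ≤-refl)
    where
    flip-not : ∀ {x b} → not x ≡ b → x ≡ not b
    flip-not {x} e = trans (sym (not-involutive x)) (cong not e)
    nomono′ : NoMonotone (not ∘ c)
    nomono′ k b p q r = nomono k (not b) (flip-not p) (flip-not q) (flip-not r)
  orient (suc (suc m)) c per sparse | inj₂ nomono =
    -- The bound 6/5 for `s = 2` is available from length 7 on, and `s ≤ 1` then fails, so nothing
    -- about → → ← ← has to be shown.
    orient-nonmonotone c 2 nomono (λ { (s≤s ()) }) (sparse 2 (s≤s (s≤s z≤n))) _ whole ≤-refl

-- From copies of the cycle to walks

-- The bound (1 + r) / r decreases in r. If e < v, the ratio is already below 1; otherwise t v ≤ t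
-- e, and t v cancels from both sides.
weaken-density : ∀ r t e v → e * (r + t) < suc (r + t) * v → e * r < suc r * v
weaken-density r t e v lt with e <? v
... | yes e<v = ≤-<-trans (≤-reflexive (*-comm e r)) (+-mono-<-≤ {0} {v} (≤-<-trans z≤n e<v) (*-monoʳ-≤ r (<⇒≤ e<v)))
... | no e≮v  = +-cancelʳ-< (t * v) _ _ (begin-strict
  e * r + t * v    ≤⟨ +-monoʳ-≤ (e * r) (*-monoʳ-≤ t (≮⇒≥ e≮v)) ⟩
  e * r + t * e    ≡⟨ collect e r t ⟩
  e * (r + t)      <⟨ lt ⟩
  suc (r + t) * v  ≡⟨ *-distribʳ-+ v (suc r) t ⟩
  suc r * v + t * v ∎)
  where
  open ≤-Reasoning
  collect : ∀ e r t → e * r + t * e ≡ e * (r + t)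
  collect = solve-∀

≡ᵇ-refl : ∀ a → (a ≡ᵇ a) ≡ true
≡ᵇ-refl zero    = refl
≡ᵇ-refl (suc a) = ≡ᵇ-refl a

module Unroll (m : ℕ) where

  ℓ : ℕ
  ℓ = 5 + m

  ix : ℕ → Fin ℓ
  ix k = fromℕ< (m%n<n k ℓ)

  toℕ-ix : ∀ k → toℕ (ix k) ≡ k % ℓ
  toℕ-ix k = toℕ-fromℕ< (m%n<n k ℓ)

  ix-period : ∀ k → ix (ℓ + k) ≡ ix k
  ix-period k = toℕ-injective (trans (toℕ-ix (ℓ + k))
    (trans (cong (_% ℓ) (+-comm ℓ k)) (trans ([m+n]%n≡m%n k ℓ) (sym (toℕ-ix k)))))

  ix-suc : ∀ k → suc (toℕ (ix k)) % ℓ ≡ toℕ (ix (1 + k))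
  ix-suc k = trans (cong (λ x → suc x % ℓ) (toℕ-ix k)) (trans (sym (%-distribˡ-+ 1 k ℓ)) (sym (toℕ-ix (1 + k))))

  ix-adjacent : ∀ k → cycleAdj ℓ (ix k) (ix (1 + k)) ≡ true
  ix-adjacent k rewrite ix-suc k | ≡ᵇ-refl (toℕ (ix (1 + k))) = refl

  -- Without wrap-around the value grows by 2; with it, equality would force the cycle length to be
  -- 2.
  +2-moves : ∀ r → r < ℓ → r ≢ (2 + r) % ℓ
  +2-moves r r<ℓ e with 2 + r <? ℓ
  ... | yes lt = m+1+n≢m r {1} (trans (+-comm r 2) (trans (sym (m<n⇒m%n≡m lt)) (sym e)))
  ... | no ¬lt = contradiction (+-cancelˡ-≡ r 2 ℓ r+2≡r+ℓ) λ ()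
    where
    t = 2 + r ∸ ℓ
    t+ℓ≡2+r : t + ℓ ≡ 2 + r
    t+ℓ≡2+r = m∸n+n≡m (≮⇒≥ ¬lt)
    t<2 : t < 2
    t<2 = +-cancelʳ-< ℓ t 2 (≤-<-trans (≤-reflexive t+ℓ≡2+r) (+-monoʳ-< 2 r<ℓ))
    r≡t : r ≡ t
    r≡t = trans e (trans (cong (_% ℓ) (sym t+ℓ≡2+r)) (trans ([m+n]%n≡m%n t ℓ) (m<n⇒m%n≡m (≤-trans t<2 (s≤s (s≤s z≤n))))))
    r+2≡r+ℓ : r + 2 ≡ r + ℓ
    r+2≡r+ℓ = trans (+-comm r 2) (trans (sym t+ℓ≡2+r) (cong (_+ ℓ) (sym r≡t)))

  ix-no-backtrack : ∀ k → ix k ≢ ix (2 + k)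
  ix-no-backtrack k e = +2-moves (k % ℓ) (m%n<n k ℓ)
    (trans (sym (toℕ-ix k)) (trans (cong toℕ e) (trans (toℕ-ix (2 + k)) (%-distribˡ-+ 2 k ℓ))))

  signs : Rel₂ ℓ → ℕ → Bool
  signs C k = C (ix k) (ix (1 + k))

  signs-periodic : ∀ C → Periodic ℓ (signs C)
  signs-periodic C k = cong₂ C (ix-period k)
    (trans (cong ix (sym (+-suc ℓ k))) (ix-period (1 + k)))

theorem17 : (ℓ : ℕ) → 5 ≤ ℓ → (C : Rel₂ ℓ) → IsOrientation (cycleAdj ℓ) C →
    (n : ℕ) (A : Rel₂ n) → IsSimpleGraph A → DensityBelow A (ℓ ∸ 1) (ℓ ∸ 2) →
    Σ (Rel₂ n) λ O → IsOrientation A O × ¬ ContainsCopy C O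
theorem17 _ (s≤s (s≤s (s≤s (s≤s (s≤s {n = m} z≤n))))) C (C-edge , _) n A (A-sym , A-irr) dense =
  finish (orient m (signs C) (signs-periodic C) sparse)
  where
  open Graph A A-sym A-irr
  open Unroll m

  sparse : ∀ s → s ≤ m → Sparse s
  -- With ℓ = 5 + `m` the given bound is (4 + m) / (3 + m), which is at most (4 + s) / (3 + s).
  sparse s s≤m S nonempty = weaken-density (3 + s) (m ∸ s) (eCount (induced S)) (vCount S)
    (subst (λ q → eCount (induced S) * (3 + q) < (4 + q) * vCount S) (sym (m+[n∸m]≡n s≤m))
      (dense S (induced S) (induced-isSubgraph S) nonempty))

  finish : Result (signs C) whole → Σ (Rel₂ n) λ O → IsOrientation A O × ¬ ContainsCopy C O
  finish (T , anti , none) = O , (O-edge , λ u v → ∧-conicalˡ (A u v) (T u v)) , no-copy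
    where
    O : Rel₂ n
    O u v = A u v ∧ T u v

    O-edge : ∀ u v → A u v ≡ true → ((O u v ≡ true) × (O v u ≡ false)) ⊎ ((O u v ≡ false) × (O v u ≡ true))
    O-edge u v a with anti u v a
    ... | opp rewrite sym (A-sym u v) | a with T u v | T v u
    ...   | true  | false = inj₁ (refl , refl)
    ...   | false | true  = inj₂ (refl , refl)

    no-copy : ¬ ContainsCopy C O
    no-copy (f , f-inj , f-arc) = none record
      { g            = λ k → f (ix k)
      ; inside       = λ _ → refl
      ; step         = λ k → proj₁ (arc k)
      ; sign         = λ k → proj₂ (arc k)
      ; no-backtrack = λ k e → ix-no-backtrack k (f-inj e)
      -- Two more than `3 + m + k` is ℓ + `k`, one full turn later.
      ; recur        = λ k → 3 + m + k , cong f (ix-period k)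
      }
      where
      arc : ∀ k → A (f (ix k)) (f (ix (1 + k))) ≡ true × T (f (ix k)) (f (ix (1 + k))) ≡ signs C k
      arc k with C-edge (ix k) (ix (1 + k)) (ix-adjacent k)
      ... | inj₁ (fwd , _) = ∧-conicalˡ _ _ o , trans (∧-conicalʳ (A _ _) _ o) (sym fwd)
        where o = f-arc (ix k) (ix (1 + k)) fwd
      -- A backward arc of `C` is mapped to an arc of `O` against the walk, so antisymmetry makes
      -- the forward value of `T` false.
      ... | inj₂ (¬fwd , bwd) = a , trans (anti _ _ a) (trans (cong not (∧-conicalʳ (A _ _) _ o)) (sym ¬fwd))
        where
        o = f-arc (ix (1 + k)) (ix k) bwd
        a = trans (A-sym _ _) (∧-conicalˡ _ _ o)
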